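{- Let $\mathcal{P}$ be a graph problem and let $\mathfrak{C}$ be a dynamic programming core that solves $\mathcal{P}$. Then, given a cliquewidth decomposition $\mathcal{D}$ of a graph $G$, one can determine whether $G \in \mathcal{P}$ in time \[\mathcal{O}\left(\tau(\mathfrak{C}, \mathcal{D}) + |V(\mathcal{D})| \cdot Size_{\mathfrak{C}, \mathcal{D}}\right).\]
   Context: All graphs are finite, simple and undirected. A graph problem $\mathcal{P}$ is a set of graphs; write $G\in\mathcal{P}$ if $G$ belongs to it. Cliquewidth decomposition: a rooted tree $\mathcal{D}$ of width $\omega$ in which every node $t$ is of one of four types: $intro(v,a)$ with $a\in[\omega]$ (a leaf; builds the one-vertex graph consisting of vertex $v$ with color $a$); $t_1\oplus t_2$ (two children; disjoint union of the colored graphs built by the children); $recolor(t',a\to b)$ (one child; recolors all vertices of color $a$ to color $b$); $addEdges(t',a,b)$ (one child; adds all edges between vertices of color $a$ and vertices of color $b$). $G_t$ denotes the colored graph built by the subtree $\mathcal{D}_t$ rooted at $t$, and $\delta(t)$ the number of children of $t$. $\mathcal{D}$ is a decomposition of $G$ if $G$ is isomorphic to $G_q$ for the root $q$. A dynamic programming core is an algorithm $\mathfrak{C}$ that, given a cliquewidth decomposition $\mathcal{D}$ of a graph $G$, produces a finite set $Accept_{\mathfrak{C},\mathcal{D}}\subseteq\{0,1\}^*$ and, for each node $t\in V(\mathcal{D})$, a finite set $Process_{\mathfrak{C},\mathcal{D}}(t)\subseteq(\{0,1\}^*)^{\delta(t)+1}$. $\tau(\mathfrak{C},\mathcal{D})$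 denotes the time needed to construct these data and $Size_{\mathfrak{C},\mathcal{D}}=\max_{t\in V(\mathcal{D})}|Process_{\mathfrak{C},\mathcal{D}}(t)|$. For $w\in\{0,1\}^*$, a $(\mathfrak{C},\mathcal{D},w)$-witness is a function $\alpha:V(\mathcal{D})\to\{0,1\}^*$ such that for every node $t$ with children $t_1,\dots,t_{\delta(t)}$ we have $(\alpha(t),\alpha(t_1),\dots,\alpha(t_{\delta(t)}))\in Process_{\mathfrak{C},\mathcal{D}}(t)$, and $\alpha(q)=w$ for the root $q$. If moreover $w\in Accept_{\mathfrak{C},\mathcal{D}}$, $\alpha$ is a $(\mathfrak{C},\mathcal{D})$-witness. $\mathfrak{C}$ solves the graph problem $\mathcal{P}$ if for every graph $G$ and every cliquewidth decomposition $\mathcal{D}$ of $G$: $G\in\mathcal{P}$ if and only if a $(\mathfrak{C},\mathcal{D})$-witness exists. -}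

module Defs where

open import Data.Bool.Base using (Bool; true; false; if_then_else_)
import Data.Bool.Properties as Bool
open import Data.Empty using (⊥)
open import Data.Fin.Base using (Fin; toℕ) renaming (zero to fzero; suc to fsuc)
import Data.Fin.Properties as Fin
open import Data.List.Base as List using (List; []; _∷_; [_]; _++_; length; deduplicate)
import Data.List.Properties as List
open import Data.List.Extrema.Nat using (max)
open import Data.List.Membership.Propositional using (_∈_)
open import Data.List.Relation.Binary.Disjoint.Propositional using (Disjoint)
open import Data.Nat.Base using (ℕ; suc; _+_; _∸_)
import Data.Nat.Properties as ℕ
open import Data.Product.Base using (Σ; ∃; ∃₂; _×_; _,_)
open import Data.Sum.Base using (_⊎_; inj₁; inj₂; [_,_]′)
open import Data.Sum.Function.Propositional using (_⊎-↔_)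
open import Data.Sum.Relation.Binary.Pointwise using (Pointwise; ⊎-symmetric; ⊎-decidable; ⊎-irreflexive; ≡⇒Pointwise-≡)
open import Data.Vec.Base as Vec using (Vec; []; _∷_; lookup)
import Data.Vec.Properties as Vec
open import Function.Base using (_∘_)
open import Function.Bundles using (_↔_; _⇔_; Inverse; mk↔ₛ′)
open import Function.Properties.Inverse using (↔-sym; ↔-trans; ↔⇒↣)
open import Level using (Level; 0ℓ)
open import Relation.Binary.Core using (Rel)
open import Relation.Binary.Definitions using (Decidable; DecidableEquality; Symmetric; Irreflexive)
open import Relation.Binary.PropositionalEquality using (_≡_; _≢_; refl; sym)
open import Relation.Nullary.Decidable using (no; does; _×-dec_; _⊎-dec_; ¬?; via-injection)
open import Relation.Unary using (Pred; ｛_｝)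

record Graph : Set₁ where
  infix 4 _~_ _~?_
  field
    Vertex   : Set
    order    : ℕ
    finite   : Vertex ↔ Fin order
    _~_      : Rel Vertex 0ℓ
    _~?_     : Decidable _~_
    ~-sym    : Symmetric _~_
    ~-irrefl : Irreflexive _≡_ _~_

  _≟ᵛ_ : DecidableEquality Vertex
  _≟ᵛ_ = via-injection (↔⇒↣ finite) Fin._≟_

infix 4 _≅_

record _≅_ (G H : Graph) : Set where
  private
    module G = Graph G
    module H = Graph H
  field
    bijection : G.Vertex ↔ H.Vertex
  open Inverse bijection using (to)
  field
    preserves : ∀ u v → u G.~ v ⇔ to u H.~ to v

GraphProblem : (ℓ : Level) → Set (Level.suc 0ℓ Level.⊔ Level.suc ℓ)
GraphProblem ℓ = Pred Graph ℓ

record ColouredGraph (ω : ℕ) : Set₁ where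
  field
    graph  : Graph
  open Graph graph public
  field
    colour : Vertex → Fin ω

singleton : ∀ {ω} → ℕ → Fin ω → ColouredGraph ω
singleton v a = record
  { graph = record
    { Vertex   = Σ ℕ ｛ v ｝
    ; order    = 1
    ; finite   = mk↔ₛ′ (λ _ → fzero) (λ _ → v , refl) (λ { fzero → refl ; (fsuc ()) }) (λ { (_ , refl) → refl })
    ; _~_      = λ _ _ → ⊥
    ; _~?_     = λ _ _ → no λ ()
    ; ~-sym    = λ ()
    ; ~-irrefl = λ _ ()
    }
  ; colour = λ _ → a
  }

disjointUnion : ∀ {ω} → ColouredGraph ω → ColouredGraph ω → ColouredGraph ω
disjointUnion G H = record
  { graph = record
    { Vertex   = G.Vertex ⊎ H.Vertex
    ; order    = G.order + H.order
    ; finite   = ↔-trans (G.finite ⊎-↔ H.finite) (↔-sym Fin.+↔⊎)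
    ; _~_      = Pointwise G._~_ H._~_
    ; _~?_     = ⊎-decidable G._~?_ H._~?_
    ; ~-sym    = ⊎-symmetric G.~-sym H.~-sym
    ; ~-irrefl = ⊎-irreflexive G.~-irrefl H.~-irrefl ∘ ≡⇒Pointwise-≡
    }
  ; colour = [ G.colour , H.colour ]′
  }
  where
  module G = ColouredGraph G
  module H = ColouredGraph H

recolour : ∀ {ω} → Fin ω → Fin ω → ColouredGraph ω → ColouredGraph ω
recolour a b G = record { graph = graph ; colour = new ∘ colour }
  where
  open ColouredGraph G
  new : Fin _ → Fin _
  new c = if does (c Fin.≟ a) then b else c

-- The condition u ≢ v only matters when a ≡ b: it keeps the graph loopless.
joinColours : ∀ {ω} → Fin ω → Fin ω → ColouredGraph ω → ColouredGraph ω
joinColours a b G = record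
  { graph = record
    { Vertex   = Vertex
    ; order    = order
    ; finite   = finite
    ; _~_      = λ u v → u ~ v ⊎ (u ≢ v × Coloured u v)
    ; _~?_     = λ u v → (u ~? v) ⊎-dec (¬? (u ≟ᵛ v) ×-dec
                   (((colour u Fin.≟ a) ×-dec (colour v Fin.≟ b)) ⊎-dec
                    ((colour u Fin.≟ b) ×-dec (colour v Fin.≟ a))))
    ; ~-sym    = λ where
        (inj₁ u~v)                      → inj₁ (~-sym u~v)
        (inj₂ (u≢v , inj₁ (u-a , v-b))) → inj₂ (u≢v ∘ sym , inj₂ (v-b , u-a))
        (inj₂ (u≢v , inj₂ (u-b , v-a))) → inj₂ (u≢v ∘ sym , inj₁ (v-a , u-b))
    ; ~-irrefl = λ where
        u≡v (inj₁ u~v)       → ~-irrefl u≡v u~v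
        u≡v (inj₂ (u≢v , _)) → u≢v u≡v
    }
  ; colour = colour
  }
  where
  open ColouredGraph G
  Coloured : Rel Vertex 0ℓ
  Coloured u v = (colour u ≡ a × colour v ≡ b) ⊎ (colour u ≡ b × colour v ≡ a)

-- Vertices are named by natural numbers, and the two sides of a union must
-- introduce different vertices.  Hence the sum type used for the vertices in
-- disjointUnion is, up to isomorphism, the union of the two vertex sets.

data Decomposition (ω : ℕ) : Set
vertices : ∀ {ω} → Decomposition ω → List ℕ

data Decomposition ω where
  intro    : (v : ℕ) (a : Fin ω) → Decomposition ω
  union    : (D₁ D₂ : Decomposition ω) → Disjoint (vertices D₁) (vertices D₂) → Decomposition ω
  recolor  : (D : Decomposition ω) (a b : Fin ω) → Decomposition ω
  addEdges : (D : Decomposition ω) (a b : Fin ω) → Decomposition ω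

vertices (intro v a)      = [ v ]
vertices (union D₁ D₂ _)  = vertices D₁ ++ vertices D₂
vertices (recolor D a b)  = vertices D
vertices (addEdges D a b) = vertices D

build : ∀ {ω} → Decomposition ω → ColouredGraph ω
build (intro v a)      = singleton v a
build (union D₁ D₂ _)  = disjointUnion (build D₁) (build D₂)
build (recolor D a b)  = recolour a b (build D)
build (addEdges D a b) = joinColours a b (build D)

infix 4 _IsDecompositionOf_

_IsDecompositionOf_ : ∀ {ω} → Decomposition ω → Graph → Set
D IsDecompositionOf G = G ≅ ColouredGraph.graph (build D)

-- A node is the path leading to it from the root.
data Node {ω} : Decomposition ω → Set where
  root        : ∀ {D} → Node D
  inLeft      : ∀ {D₁ D₂} {d : Disjoint (vertices D₁) (vertices D₂)} → Node D₁ → Node (union D₁ D₂ d)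
  inRight     : ∀ {D₁ D₂} {d : Disjoint (vertices D₁) (vertices D₂)} → Node D₂ → Node (union D₁ D₂ d)
  inRecolor   : ∀ {D a b} → Node D → Node (recolor D a b)
  inAddEdges  : ∀ {D a b} → Node D → Node (addEdges D a b)

δ : ∀ {ω} {D : Decomposition ω} → Node D → ℕ
δ {D = intro v a}      root = 0
δ {D = union D₁ D₂ _}  root = 2
δ {D = recolor D a b}  root = 1
δ {D = addEdges D a b} root = 1
δ (inLeft t)     = δ t
δ (inRight t)    = δ t
δ (inRecolor t)  = δ t
δ (inAddEdges t) = δ t

children : ∀ {ω} {D : Decomposition ω} (t : Node D) → Vec (Node D) (δ t)
children {D = intro v a}      root = []
children {D = union D₁ D₂ _}  root = inLeft root ∷ inRight root ∷ []
children {D = recolor D a b}  root = inRecolor root ∷ []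
children {D = addEdges D a b} root = inAddEdges root ∷ []
children (inLeft t)     = Vec.map inLeft (children t)
children (inRight t)    = Vec.map inRight (children t)
children (inRecolor t)  = Vec.map inRecolor (children t)
children (inAddEdges t) = Vec.map inAddEdges (children t)

nodes : ∀ {ω} (D : Decomposition ω) → List (Node D)
nodes (intro v a)      = root ∷ []
nodes (union D₁ D₂ _)  = root ∷ List.map inLeft (nodes D₁) ++ List.map inRight (nodes D₂)
nodes (recolor D a b)  = root ∷ List.map inRecolor (nodes D)
nodes (addEdges D a b) = root ∷ List.map inAddEdges (nodes D)

∣V_∣ : ∀ {ω} → Decomposition ω → ℕ
∣V D ∣ = length (nodes D)

-- A unit-cost random access machine, presented as a first-order recursive
-- language.  Every operation costs one unit of time.  Registers and memory
-- cells hold a natural number or (a pointer to) an immutable pair; as usual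
-- for the unit-cost measure, the arithmetic is limited to _+_ and _∸_.

data Val : Set where
  num : ℕ → Val
  ⟨_,_⟩ : Val → Val → Val

Store : Set
Store = ℕ → Val

_[_≔_] : Store → ℕ → Val → Store
(σ [ i ≔ x ]) j = if does (i ℕ.≟ j) then x else σ j

-- k is the number of (unary) functions that may be called, n the number of
-- local variables in scope.
data Expr (k : ℕ) : ℕ → Set where
  var    : ∀ {n} → Fin n → Expr k n
  lit    : ∀ {n} → ℕ → Expr k n
  add    : ∀ {n} → Expr k n → Expr k n → Expr k n
  sub    : ∀ {n} → Expr k n → Expr k n → Expr k n
  pair   : ∀ {n} → Expr k n → Expr k n → Expr k n
  fst    : ∀ {n} → Expr k n → Expr k n
  snd    : ∀ {n} → Expr k n → Expr k n
  ifElse : ∀ {n} → Expr k n → Expr k n → Expr k n → Expr k n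
  letIn  : ∀ {n} → Expr k n → Expr k (suc n) → Expr k n
  call   : ∀ {n} → Fin k → Expr k n → Expr k n
  load   : ∀ {n} → Expr k n → Expr k n
  store  : ∀ {n} → Expr k n → Expr k n → Expr k n

record Program : Set where
  field
    functions : ℕ
    body      : Fin functions → Expr functions 1
    main      : Expr functions 1

data IsTrue : Val → Set where
  num  : ∀ {i} → IsTrue (num (suc i))
  pair : ∀ {x y} → IsTrue ⟨ x , y ⟩

infix 3 _⊢⟨_∣_∣_⟩⇓⟨_∣_∣_⟩

-- body ⊢⟨ e ∣ ρ ∣ σ ⟩⇓⟨ x ∣ σ′ ∣ t ⟩ : in the environment ρ and with memory σ,
-- e evaluates to x in time t and leaves the memory σ′.
data _⊢⟨_∣_∣_⟩⇓⟨_∣_∣_⟩ {k} (body : Fin k → Expr k 1) {n} :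
     Expr k n → Vec Val n → Store → Val → Store → ℕ → Set where

  var : ∀ {i ρ σ} →
    body ⊢⟨ var i ∣ ρ ∣ σ ⟩⇓⟨ lookup ρ i ∣ σ ∣ 1 ⟩

  lit : ∀ {i ρ σ} →
    body ⊢⟨ lit i ∣ ρ ∣ σ ⟩⇓⟨ num i ∣ σ ∣ 1 ⟩

  add : ∀ {e₁ e₂ ρ σ σ₁ σ₂ i j t₁ t₂} →
    body ⊢⟨ e₁ ∣ ρ ∣ σ ⟩⇓⟨ num i ∣ σ₁ ∣ t₁ ⟩ →
    body ⊢⟨ e₂ ∣ ρ ∣ σ₁ ⟩⇓⟨ num j ∣ σ₂ ∣ t₂ ⟩ →
    body ⊢⟨ add e₁ e₂ ∣ ρ ∣ σ ⟩⇓⟨ num (i + j) ∣ σ₂ ∣ suc (t₁ + t₂) ⟩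

  sub : ∀ {e₁ e₂ ρ σ σ₁ σ₂ i j t₁ t₂} →
    body ⊢⟨ e₁ ∣ ρ ∣ σ ⟩⇓⟨ num i ∣ σ₁ ∣ t₁ ⟩ →
    body ⊢⟨ e₂ ∣ ρ ∣ σ₁ ⟩⇓⟨ num j ∣ σ₂ ∣ t₂ ⟩ →
    body ⊢⟨ sub e₁ e₂ ∣ ρ ∣ σ ⟩⇓⟨ num (i ∸ j) ∣ σ₂ ∣ suc (t₁ + t₂) ⟩

  pair : ∀ {e₁ e₂ ρ σ σ₁ σ₂ x y t₁ t₂} →
    body ⊢⟨ e₁ ∣ ρ ∣ σ ⟩⇓⟨ x ∣ σ₁ ∣ t₁ ⟩ →
    body ⊢⟨ e₂ ∣ ρ ∣ σ₁ ⟩⇓⟨ y ∣ σ₂ ∣ t₂ ⟩ →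
    body ⊢⟨ pair e₁ e₂ ∣ ρ ∣ σ ⟩⇓⟨ ⟨ x , y ⟩ ∣ σ₂ ∣ suc (t₁ + t₂) ⟩

  fst : ∀ {e ρ σ σ₁ x y t} →
    body ⊢⟨ e ∣ ρ ∣ σ ⟩⇓⟨ ⟨ x , y ⟩ ∣ σ₁ ∣ t ⟩ →
    body ⊢⟨ fst e ∣ ρ ∣ σ ⟩⇓⟨ x ∣ σ₁ ∣ suc t ⟩

  snd : ∀ {e ρ σ σ₁ x y t} →
    body ⊢⟨ e ∣ ρ ∣ σ ⟩⇓⟨ ⟨ x , y ⟩ ∣ σ₁ ∣ t ⟩ →
    body ⊢⟨ snd e ∣ ρ ∣ σ ⟩⇓⟨ y ∣ σ₁ ∣ suc t ⟩

  ifTrue : ∀ {e e₁ e₂ ρ σ σ₁ σ₂ c x t t₁} →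
    body ⊢⟨ e ∣ ρ ∣ σ ⟩⇓⟨ c ∣ σ₁ ∣ t ⟩ → IsTrue c →
    body ⊢⟨ e₁ ∣ ρ ∣ σ₁ ⟩⇓⟨ x ∣ σ₂ ∣ t₁ ⟩ →
    body ⊢⟨ ifElse e e₁ e₂ ∣ ρ ∣ σ ⟩⇓⟨ x ∣ σ₂ ∣ suc (t + t₁) ⟩

  ifFalse : ∀ {e e₁ e₂ ρ σ σ₁ σ₂ x t t₂} →
    body ⊢⟨ e ∣ ρ ∣ σ ⟩⇓⟨ num 0 ∣ σ₁ ∣ t ⟩ →
    body ⊢⟨ e₂ ∣ ρ ∣ σ₁ ⟩⇓⟨ x ∣ σ₂ ∣ t₂ ⟩ →
    body ⊢⟨ ifElse e e₁ e₂ ∣ ρ ∣ σ ⟩⇓⟨ x ∣ σ₂ ∣ suc (t + t₂) ⟩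

  letIn : ∀ {e₁ e₂ ρ σ σ₁ σ₂ x y t₁ t₂} →
    body ⊢⟨ e₁ ∣ ρ ∣ σ ⟩⇓⟨ x ∣ σ₁ ∣ t₁ ⟩ →
    body ⊢⟨ e₂ ∣ x ∷ ρ ∣ σ₁ ⟩⇓⟨ y ∣ σ₂ ∣ t₂ ⟩ →
    body ⊢⟨ letIn e₁ e₂ ∣ ρ ∣ σ ⟩⇓⟨ y ∣ σ₂ ∣ suc (t₁ + t₂) ⟩

  call : ∀ {f e ρ σ σ₁ σ₂ x y t₁ t₂} →
    body ⊢⟨ e ∣ ρ ∣ σ ⟩⇓⟨ x ∣ σ₁ ∣ t₁ ⟩ →
    body ⊢⟨ body f ∣ x ∷ [] ∣ σ₁ ⟩⇓⟨ y ∣ σ₂ ∣ t₂ ⟩ →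
    body ⊢⟨ call f e ∣ ρ ∣ σ ⟩⇓⟨ y ∣ σ₂ ∣ suc (t₁ + t₂) ⟩

  load : ∀ {e ρ σ σ₁ i t} →
    body ⊢⟨ e ∣ ρ ∣ σ ⟩⇓⟨ num i ∣ σ₁ ∣ t ⟩ →
    body ⊢⟨ load e ∣ ρ ∣ σ ⟩⇓⟨ σ₁ i ∣ σ₁ ∣ suc t ⟩

  store : ∀ {e₁ e₂ ρ σ σ₁ σ₂ i x t₁ t₂} →
    body ⊢⟨ e₁ ∣ ρ ∣ σ ⟩⇓⟨ num i ∣ σ₁ ∣ t₁ ⟩ →
    body ⊢⟨ e₂ ∣ ρ ∣ σ₁ ⟩⇓⟨ x ∣ σ₂ ∣ t₂ ⟩ →
    body ⊢⟨ store e₁ e₂ ∣ ρ ∣ σ ⟩⇓⟨ x ∣ σ₂ [ i ≔ x ] ∣ suc (t₁ + t₂) ⟩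

size : Val → ℕ
size (num _)   = 1
size ⟨ x , y ⟩ = suc (size x + size y)

-- The running time comprises the evaluation and the writing of the result.
-- The latter is not implied by the former, since pairs can be shared in memory.
Runs : Program → Val → Val → ℕ → Set
Runs P x y n = ∃₂ λ σ t →
  (body ⊢⟨ main ∣ x ∷ [] ∣ (λ _ → num 0) ⟩⇓⟨ y ∣ σ ∣ t ⟩) × n ≡ t + size y
  where open Program P

Word : Set
Word = List Bool

encodeBool : Bool → Val
encodeBool false = num 0
encodeBool true  = num 1

encodeList : List Val → Val
encodeList []       = num 0
encodeList (x ∷ xs) = ⟨ x , encodeList xs ⟩

encodeWord : Word → Val
encodeWord w = encodeList (List.map encodeBool w)

encodeWords : List Word → Val
encodeWords ws = encodeList (List.map encodeWord ws)

encodeTuples : ∀ {n} → List (Vec Word n) → Val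
encodeTuples ts = encodeList (List.map (encodeWords ∘ Vec.toList) ts)

encodeTree : ∀ {ω} → Decomposition ω → Val
encodeTree (intro v a)      = ⟨ num 0 , ⟨ num v , num (toℕ a) ⟩ ⟩
encodeTree (union D₁ D₂ _)  = ⟨ num 1 , ⟨ encodeTree D₁ , encodeTree D₂ ⟩ ⟩
encodeTree (recolor D a b)  = ⟨ num 2 , ⟨ encodeTree D , ⟨ num (toℕ a) , num (toℕ b) ⟩ ⟩ ⟩
encodeTree (addEdges D a b) = ⟨ num 3 , ⟨ encodeTree D , ⟨ num (toℕ a) , num (toℕ b) ⟩ ⟩ ⟩

encodeDecomposition : ∀ {ω} → Decomposition ω → Val
encodeDecomposition {ω} D = ⟨ num ω , encodeTree D ⟩

-- A family of values indexed by the nodes is written as a tree of the shape of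
-- D, each node carrying its value and the list of its subtrees.
encodeFamily : ∀ {ω} (D : Decomposition ω) → (Node D → Val) → Val
encodeFamily (intro v a)      f = ⟨ f root , encodeList [] ⟩
encodeFamily (union D₁ D₂ _)  f =
  ⟨ f root , encodeList (encodeFamily D₁ (f ∘ inLeft) ∷ encodeFamily D₂ (f ∘ inRight) ∷ []) ⟩
encodeFamily (recolor D a b)  f = ⟨ f root , encodeList (encodeFamily D (f ∘ inRecolor) ∷ []) ⟩
encodeFamily (addEdges D a b) f = ⟨ f root , encodeList (encodeFamily D (f ∘ inAddEdges) ∷ []) ⟩

-- A finite set is given by a list enumerating it, possibly with repetitions.
card : ∀ {A : Set} → DecidableEquality A → List A → ℕ
card _≟_ xs = length (deduplicate _≟_ xs)

record Core : Set where
  field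
    program : Program
    Accept  : ∀ {ω} → Decomposition ω → List Word
    Process : ∀ {ω} (D : Decomposition ω) (t : Node D) → List (Vec Word (suc (δ t)))
    τ       : ∀ {ω} → Decomposition ω → ℕ
    runs    : ∀ {ω} (D : Decomposition ω) →
              Runs program (encodeDecomposition D)
                ⟨ encodeWords (Accept D) , encodeFamily D (λ t → encodeTuples (Process D t)) ⟩
                (τ D)

  Size : ∀ {ω} → Decomposition ω → ℕ
  Size D = max 0 (List.map (λ t → card (Vec.≡-dec (List.≡-dec Bool._≟_)) (Process D t)) (nodes D))

module _ (ℭ : Core) {ω} (D : Decomposition ω) where
  open Core ℭ

  IsWitnessFor : Word → (Node D → Word) → Set
  IsWitnessFor w α =
    (∀ t → (α t ∷ Vec.map α (children t)) ∈ Process D t) × α root ≡ w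

  IsWitness : (Node D → Word) → Set
  IsWitness α = ∃ λ w → IsWitnessFor w α × w ∈ Accept D

Solves : ∀ {ℓ} → Core → GraphProblem ℓ → Set (Level.suc 0ℓ Level.⊔ ℓ)
Solves ℭ 𝒫 = ∀ (G : Graph) {ω} (D : Decomposition ω) → D IsDecompositionOf G →
  𝒫 G ⇔ ∃ (IsWitness ℭ D)

{-# OPTIONS --safe #-}

-- The running time τ of the core includes writing its output, so it suffices to
-- search for a witness in time linear in the size of that output.  Bottom-up, the
-- solutions of a node are the tuples in its relation whose entries for the children
-- are solutions of the children.  They are found by one pass per child: a word is
-- read as the binary numeral of a memory address, the addresses of all entries to
-- be tested are set to 0, those of the child's solutions to 1, and then every tuple
-- is tested by a single load.  Clearing first means that nothing is assumed about
-- the memory left behind by the core or by earlier passes.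

module Submission where

open import Defs
open import Data.Bool.Base using (Bool; true; false; if_then_else_)
import Data.Bool.Properties as Bool
open import Data.Fin.Base using (Fin; _↑ʳ_) renaming (suc to fsuc)
open import Data.Fin.Patterns using (0F; 1F; 2F; 3F; 4F; 5F)
open import Data.List.Base as List using (List; []; _∷_; filter)
import Data.List.Properties as List
open import Data.List.Membership.Propositional using (_∈_; _∉_)
open import Data.List.Membership.Propositional.Properties using (∈-map⁺; ∈-map⁻; ∈-filter⁺; ∈-filter⁻)
import Data.List.Membership.DecPropositional as DecMembership
open import Data.List.Relation.Unary.All as All using (All; []; _∷_)
open import Data.List.Relation.Unary.Any using (here; there)
open import Data.Nat.Base using (ℕ; suc; _+_; _*_; _≤_; z≤n; s≤s; NonZero; >-nonZero)
open import Data.Nat.Properties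
open import Data.Nat.Tactic.RingSolver using (solve-∀)
open import Data.Product.Base using (Σ; ∃; ∃₂; _×_; _,_)
open import Data.Vec.Base as Vec using (Vec; []; _∷_)
import Data.Vec.Properties as Vec
open import Function.Base using (_∘_)
open import Function.Bundles using (Equivalence)
open import Relation.Binary.PropositionalEquality using (_≡_; _≢_; refl; sym; trans; cong; subst)
open import Relation.Nullary.Decidable.Core using (Dec; does; yes; no)
open import Relation.Nullary.Decidable using (map′; True; toWitness; from-yes; dec-true; dec-false)
open import Relation.Nullary.Negation.Core using (contradiction)
open import Relation.Unary using (Pred; Decidable)

open DecMembership (List.≡-dec Bool._≟_) using (_∈?_)

-- Embedding a program into a larger one

embed : ∀ {k m} → (Fin k → Fin m) → ∀ {n} → Expr k n → Expr m n
embed ι (var i)          = var i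
embed ι (lit i)          = lit i
embed ι (add e₁ e₂)      = add (embed ι e₁) (embed ι e₂)
embed ι (sub e₁ e₂)      = sub (embed ι e₁) (embed ι e₂)
embed ι (pair e₁ e₂)     = pair (embed ι e₁) (embed ι e₂)
embed ι (fst e)          = fst (embed ι e)
embed ι (snd e)          = snd (embed ι e)
embed ι (ifElse e e₁ e₂) = ifElse (embed ι e) (embed ι e₁) (embed ι e₂)
embed ι (letIn e₁ e₂)    = letIn (embed ι e₁) (embed ι e₂)
embed ι (call f e)       = call (ι f) (embed ι e)
embed ι (load e)         = load (embed ι e)
embed ι (store e₁ e₂)    = store (embed ι e₁) (embed ι e₂)

module _ {k m} {body : Fin k → Expr k 1} {body′ : Fin m → Expr m 1} (ι : Fin k → Fin m)
         (agree : ∀ f → body′ (ι f) ≡ embed ι (body f)) where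

  -- Each rule is matched by the same rule at the same cost, so the core's running time carries over
  -- exactly. Only a call consults `agree`.
  embed-⇓ : ∀ {n} {e : Expr k n} {ρ σ x σ′ t} →
            body ⊢⟨ e ∣ ρ ∣ σ ⟩⇓⟨ x ∣ σ′ ∣ t ⟩ → body′ ⊢⟨ embed ι e ∣ ρ ∣ σ ⟩⇓⟨ x ∣ σ′ ∣ t ⟩
  embed-⇓ var              = var
  embed-⇓ lit              = lit
  embed-⇓ (add d₁ d₂)      = add (embed-⇓ d₁) (embed-⇓ d₂)
  embed-⇓ (sub d₁ d₂)      = sub (embed-⇓ d₁) (embed-⇓ d₂)
  embed-⇓ (pair d₁ d₂)     = pair (embed-⇓ d₁) (embed-⇓ d₂)
  embed-⇓ (fst d)          = fst (embed-⇓ d)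
  embed-⇓ (snd d)          = snd (embed-⇓ d)
  embed-⇓ (ifTrue d c d₁)  = ifTrue (embed-⇓ d) c (embed-⇓ d₁)
  embed-⇓ (ifFalse d d₂)   = ifFalse (embed-⇓ d) (embed-⇓ d₂)
  embed-⇓ (letIn d₁ d₂)    = letIn (embed-⇓ d₁) (embed-⇓ d₂)
  embed-⇓ (call {f} d₁ d₂) = call (embed-⇓ d₁)
    (subst (λ e → body′ ⊢⟨ e ∣ _ ∣ _ ⟩⇓⟨ _ ∣ _ ∣ _ ⟩) (sym (agree f)) (embed-⇓ d₂))
  embed-⇓ (load d)         = load (embed-⇓ d)
  embed-⇓ (store d₁ d₂)    = store (embed-⇓ d₁) (embed-⇓ d₂)

-- Words as memory addresses

bit : Bool → ℕ
bit false = 0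
bit true  = 1

encodeBool-bit : ∀ b → encodeBool b ≡ num (bit b)
encodeBool-bit false = refl
encodeBool-bit true  = refl

-- Bijective base 2; unit-cost addition makes it computable in linear time.
code : Word → ℕ
code []      = 0
code (b ∷ w) = suc (bit b + 2 * code w)

code-injective : ∀ {v w} → code v ≡ code w → v ≡ w
code-injective {[]}        {[]}        _  = refl
code-injective {false ∷ v} {false ∷ w} eq =
  cong (false ∷_) (code-injective (*-cancelˡ-≡ _ _ 2 (suc-injective eq)))
code-injective {false ∷ v} {true ∷ w}  eq =
  contradiction (suc-injective eq) (even≢odd (code v) (code w))
code-injective {true ∷ v}  {false ∷ w} eq =
  contradiction (sym (suc-injective eq)) (even≢odd (code w) (code v))
code-injective {true ∷ v}  {true ∷ w}  eq =
  cong (true ∷_) (code-injective (*-cancelˡ-≡ _ _ 2 (suc-injective (suc-injective eq))))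

update-≡ : ∀ σ i x → (σ [ i ≔ x ]) i ≡ x
update-≡ σ i x = cong (λ b → if b then x else σ i) (dec-true (i ≟ i) refl)

update-≢ : ∀ σ {i j} x → i ≢ j → (σ [ i ≔ x ]) j ≡ σ j
update-≢ σ {i} {j} x i≢j = cong (λ b → if b then x else σ j) (dec-false (i ≟ j) i≢j)

setAll : List Word → Val → Store → Store
setAll []       x σ = σ
setAll (w ∷ ws) x σ = setAll ws x (σ [ code w ≔ x ])

-- A later write at the same address stores the same value, so repetitions in the list do no harm.
setAll-stable : ∀ ws {x} σ {i} → σ i ≡ x → setAll ws x σ i ≡ x
setAll-stable []       σ eq = eq
setAll-stable (w ∷ ws) {x} σ {i} eq = setAll-stable ws _ updated
  where
  updated : (σ [ code w ≔ x ]) i ≡ x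
  updated with code w ≟ i
  ... | yes refl = update-≡ σ (code w) x
  ... | no w≢i   = trans (update-≢ σ x w≢i) eq

setAll-∈ : ∀ {w ws x} σ → w ∈ ws → setAll ws x σ (code w) ≡ x
setAll-∈ {w} {ws = _ ∷ ws} {x} σ (here refl) = setAll-stable ws _ (update-≡ σ (code w) x)
setAll-∈ σ (there w∈ws) = setAll-∈ _ w∈ws

setAll-∉ : ∀ {w} ws {x} σ → w ∉ ws → setAll ws x σ (code w) ≡ σ (code w)
setAll-∉ []       σ _ = refl
setAll-∉ (v ∷ ws) {x} σ w∉ = trans (setAll-∉ ws _ (w∉ ∘ there))
  (update-≢ σ x (w∉ ∘ here ∘ sym ∘ code-injective))

-- Membership of `w` in `vs` guarantees that its cell was cleared; if `w` is not in `ws`,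
-- injectivity of `code` keeps the marking away from that cell.
setAll-∈? : ∀ {w vs} ws σ → w ∈ vs →
            setAll ws (num 1) (setAll vs (num 0) σ) (code w) ≡ encodeBool (does (w ∈? ws))
setAll-∈? {w} ws σ w∈vs with w ∈? ws
... | yes w∈ws = setAll-∈ _ w∈ws
... | no w∉ws  = trans (setAll-∉ ws _ w∉ws) (setAll-∈ σ w∈vs)

-- Joining a relation with the solutions of a child

key : ∀ {n} → Vec Word (2 + n) → Word
key (w ∷ k ∷ ws) = k

dropKey : ∀ {n} → Vec Word (2 + n) → Vec Word (1 + n)
dropKey (w ∷ k ∷ ws) = w ∷ ws

KeyIn : ∀ {n} → List (Vec Word 1) → Pred (Vec Word (2 + n)) _
KeyIn S v = key v ∈ List.map Vec.head S

keyIn? : ∀ {n} (S : List (Vec Word 1)) → Decidable (KeyIn {n} S)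
keyIn? S v = key v ∈? List.map Vec.head S

-- A semijoin on the entry of the first remaining child, followed by projecting that entry away.
sift : ∀ {n} → List (Vec Word (2 + n)) → List (Vec Word 1) → List (Vec Word (1 + n))
sift L S = List.map dropKey (filter (keyIn? S) L)

sift⁺ : ∀ {n} {L : List (Vec Word (2 + n))} {S w k ws} →
        (w ∷ k ∷ ws) ∈ L → (k ∷ []) ∈ S → (w ∷ ws) ∈ sift L S
sift⁺ {S = S} v∈L k∈S = ∈-map⁺ dropKey (∈-filter⁺ (keyIn? S) v∈L (∈-map⁺ Vec.head k∈S))

sift⁻ : ∀ {n} {L : List (Vec Word (2 + n))} {S w ws} →
        (w ∷ ws) ∈ sift L S → ∃ λ k → (w ∷ k ∷ ws) ∈ L × (k ∷ []) ∈ S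
sift⁻ {S = S} v∈ with ∈-map⁻ dropKey v∈
... | (w ∷ k ∷ ws) , u∈ , refl with ∈-filter⁻ (keyIn? S) u∈
... | u∈L , k∈S with ∈-map⁻ Vec.head k∈S
... | (.k ∷ []) , k∈S′ , refl = k , u∈L , k∈S′

-- Solutions of a decomposition and witnesses

Relation : ∀ {ω} → Decomposition ω → Set
Relation D = (t : Node D) → List (Vec Word (suc (δ t)))

Consistent : ∀ {ω} {D : Decomposition ω} → Relation D → (Node D → Word) → Set
Consistent P α = ∀ t → (α t ∷ Vec.map α (children t)) ∈ P t

solutions : ∀ {ω} (D : Decomposition ω) → Relation D → List (Vec Word 1)
solutions (intro v a)      P = P root
solutions (union D₁ D₂ _)  P =
  -- The inner `sift` removes the left child's entry, which moves the right child's entry into the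
  -- key position.
  sift (sift (P root) (solutions D₁ (P ∘ inLeft))) (solutions D₂ (P ∘ inRight))
solutions (recolor D a b)  P = sift (P root) (solutions D (P ∘ inRecolor))
solutions (addEdges D a b) P = sift (P root) (solutions D (P ∘ inAddEdges))

-- `children` maps the injection of a subtree over a vector of children, so passing from `α` on the
-- whole tree to `α ∘ i` on the subtree fuses two maps.
restrict : ∀ {A B : Set} {m} {L : List (Vec Word (suc m))} (α : B → Word) (i : A → B) {a} {as : Vec A m} →
           (α (i a) ∷ Vec.map α (Vec.map i as)) ∈ L → (α (i a) ∷ Vec.map (α ∘ i) as) ∈ L
restrict {L = L} α i {a} {as} = subst (λ ws → (α (i a) ∷ ws) ∈ L) (sym (Vec.map-∘ α i as))

extend : ∀ {A B : Set} {m} {L : List (Vec Word (suc m))} (α : B → Word) (i : A → B) {a} {as : Vec A m} →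
         (α (i a) ∷ Vec.map (α ∘ i) as) ∈ L → (α (i a) ∷ Vec.map α (Vec.map i as)) ∈ L
extend {L = L} α i {a} {as} = subst (λ ws → (α (i a) ∷ ws) ∈ L) (Vec.map-∘ α i as)

solutions⁺ : ∀ {ω} (D : Decomposition ω) {P : Relation D} {α} →
             Consistent P α → (α root ∷ []) ∈ solutions D P
solutions⁺ (intro v a)      h = h root
solutions⁺ (union D₁ D₂ _) {α = α} h = sift⁺
  (sift⁺ (h root) (solutions⁺ D₁ {α = α ∘ inLeft} (restrict α inLeft ∘ h ∘ inLeft)))
  (solutions⁺ D₂ {α = α ∘ inRight} (restrict α inRight ∘ h ∘ inRight))
solutions⁺ (recolor D a b) {α = α} h =
  sift⁺ (h root) (solutions⁺ D {α = α ∘ inRecolor} (restrict α inRecolor ∘ h ∘ inRecolor))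
solutions⁺ (addEdges D a b) {α = α} h =
  sift⁺ (h root) (solutions⁺ D {α = α ∘ inAddEdges} (restrict α inAddEdges ∘ h ∘ inAddEdges))

-- Assignments on the subtrees can be chosen independently and glued, because distinct subtrees
-- share no nodes; the keys recovered by `sift⁻` fix their values at the subtree roots.
solutions⁻ : ∀ {ω} (D : Decomposition ω) {P : Relation D} {w} →
             (w ∷ []) ∈ solutions D P → ∃ λ α → Consistent P α × α root ≡ w
solutions⁻ (intro v a) {w = w} w∈ = (λ _ → w) , (λ { root → w∈ }) , refl
solutions⁻ (union D₁ D₂ _) {P} {w} w∈ with sift⁻ w∈
... | w₂ , w∈′ , w₂∈ with sift⁻ w∈′
... | w₁ , w∈P , w₁∈ with solutions⁻ D₁ w₁∈ | solutions⁻ D₂ w₂∈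
... | α₁ , h₁ , refl | α₂ , h₂ , refl = α , h , refl
  where
  α : Node _ → Word
  α root        = w
  α (inLeft t)  = α₁ t
  α (inRight t) = α₂ t
  h : Consistent P α
  h root        = w∈P
  h (inLeft t)  = extend α inLeft (h₁ t)
  h (inRight t) = extend α inRight (h₂ t)
solutions⁻ (recolor D a b) {P} {w} w∈ with sift⁻ w∈
... | w₁ , w∈P , w₁∈ with solutions⁻ D w₁∈
... | α₁ , h₁ , refl = α , h , refl
  where
  α : Node _ → Word
  α root          = w
  α (inRecolor t) = α₁ t
  h : Consistent P α
  h root          = w∈P
  h (inRecolor t) = extend α inRecolor (h₁ t)
solutions⁻ (addEdges D a b) {P} {w} w∈ with sift⁻ w∈
... | w₁ , w∈P , w₁∈ with solutions⁻ D w₁∈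
... | α₁ , h₁ , refl = α , h , refl
  where
  α : Node _ → Word
  α root           = w
  α (inAddEdges t) = α₁ t
  h : Consistent P α
  h root           = w∈P
  h (inAddEdges t) = extend α inAddEdges (h₁ t)

-- The second copy is the key matched against the solutions at the root; the first survives
-- `dropKey`.
duplicate : Word → Vec Word 2
duplicate w = w ∷ w ∷ []

-- The accepted words act as the relation of an additional node above the root.
accepted : (ℭ : Core) → ∀ {ω} → Decomposition ω → List (Vec Word 1)
accepted ℭ D = sift (List.map duplicate (Core.Accept ℭ D)) (solutions D (Core.Process ℭ D))

accepted⁺ : ∀ (ℭ : Core) {ω} (D : Decomposition ω) → ∃ (IsWitness ℭ D) → ∃ (_∈ accepted ℭ D)
accepted⁺ ℭ D (α , w , (h , refl) , w∈A) =
  w ∷ [] , sift⁺ (∈-map⁺ duplicate w∈A) (solutions⁺ D h)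

accepted⁻ : ∀ (ℭ : Core) {ω} (D : Decomposition ω) → ∃ (_∈ accepted ℭ D) → ∃ (IsWitness ℭ D)
accepted⁻ ℭ D (w ∷ [] , w∈) with sift⁻ w∈
... | k , v∈ , k∈ with ∈-map⁻ duplicate v∈
... | _ , w∈A , refl with solutions⁻ D k∈
... | α , h , refl = α , w , (h , refl) , w∈A

-- The program

pattern code#   = 0F
pattern clear#  = 1F
pattern mark#   = 2F
pattern select# = 3F
pattern loop#   = 4F
pattern dup#    = 5F

setBody : ∀ {k} → Fin (6 + k) → Expr (6 + k) 1 → ℕ → Expr (6 + k) 1
setBody self e i = ifElse (var 0F)
  (letIn (store (call code# e) (lit i)) (call self (snd (var 1F))))
  (lit 0)

-- Constants and size estimates for the running time

absorb : ∀ c {k a t s} → k ≤ c * a → t ≤ c * s → k + t ≤ c * (a + s)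
absorb c {a = a} {s = s} k≤ t≤ = ≤-trans (+-mono-≤ k≤ t≤) (≤-reflexive (sym (*-distribˡ-+ c a s)))

-- The constant `k` is charged to the pair cell, the two subcomputations to its components.
absorb₂ : ∀ c {k t₁ t₂ s₁ s₂} → k ≤ c → t₁ ≤ c * s₁ → t₂ ≤ c * s₂ → k + (t₁ + t₂) ≤ c * suc (s₁ + s₂)
absorb₂ c k≤ t₁≤ t₂≤ = absorb c {a = 1} (≤-trans k≤ (≤-reflexive (sym (*-identityʳ c)))) (absorb c t₁≤ t₂≤)

-- Exceeds the constant cost of every step of the program; opaque, for otherwise
-- c₀ * n unfolds to a sum of 32 terms.
opaque
  c₀ : ℕ
  c₀ = 32

  32≤c₀ : 32 ≤ c₀
  32≤c₀ = ≤-refl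

≤c₀ : ∀ k {k≤32 : True (k ≤? 32)} → k ≤ c₀
≤c₀ k {k≤32} = ≤-trans (toWitness k≤32) 32≤c₀

≤c₀* : ∀ k n {k≤32 : True (k ≤? 32)} → k ≤ c₀ * suc n
≤c₀* k n {k≤32} = ≤-trans (≤c₀ k {k≤32}) (m≤m*n c₀ (suc n))

-- Twice `c₀`, because the keys of a relation are traversed twice, for clearing and for selecting,
-- each time at rate `c₀`.
c₁ : ℕ
c₁ = 2 * c₀

size-positive : ∀ x → 1 ≤ size x
size-positive (num _)   = s≤s z≤n
size-positive ⟨ _ , _ ⟩ = s≤s z≤n

size-heads : ∀ (S : List (Vec Word 1)) → size (encodeWords (List.map Vec.head S)) ≤ size (encodeTuples S)
size-heads []             = ≤-refl
size-heads ((w ∷ []) ∷ S) = s≤s (+-mono-≤ (m≤n⇒m≤1+n (m≤m+n _ 1)) (size-heads S))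

-- The keys and the surviving shortened tuples are disjoint parts of the relation: the cell that
-- held a key inside its tuple becomes a cell of the key list. The extra unit is the second list
-- terminator.
size-sift : ∀ {n} (L : List (Vec Word (2 + n))) S →
            size (encodeWords (List.map key L)) + size (encodeTuples (sift L S)) ≤ suc (size (encodeTuples L))
size-sift []                 S = ≤-refl
size-sift ((w ∷ k ∷ ws) ∷ L) S with does (keyIn? S (w ∷ k ∷ ws)) | size-sift L S
... | true  | ih = begin
  (1 + (k′ + x)) + (1 + ((1 + (w′ + r)) + y))        ≡⟨ lhs w′ k′ r x y ⟩
  3 + w′ + k′ + r + (x + y)                          ≤⟨ +-monoʳ-≤ (3 + w′ + k′ + r) ih ⟩
  3 + w′ + k′ + r + (1 + z)                          ≡⟨ rhs w′ k′ r z ⟩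
  1 + (1 + ((1 + (w′ + (1 + (k′ + r)))) + z))        ∎
  where
  open ≤-Reasoning
  w′ = size (encodeWord w)
  k′ = size (encodeWord k)
  r  = size (encodeWords (Vec.toList ws))
  x  = size (encodeWords (List.map key L))
  y  = size (encodeTuples (sift L S))
  z  = size (encodeTuples L)
  lhs : ∀ w k r x y → (1 + (k + x)) + (1 + ((1 + (w + r)) + y)) ≡ 3 + w + k + r + (x + y)
  lhs = solve-∀
  rhs : ∀ w k r z → 3 + w + k + r + (1 + z) ≡ 1 + (1 + ((1 + (w + (1 + (k + r)))) + z))
  rhs = solve-∀
... | false | ih = begin
  (1 + (k′ + x)) + y                                 ≡⟨ +-assoc (1 + k′) x y ⟩
  1 + k′ + (x + y)                                   ≤⟨ +-monoʳ-≤ (1 + k′) ih ⟩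
  1 + k′ + (1 + z)                                   ≤⟨ m≤m+n _ (2 + w′ + r) ⟩
  1 + k′ + (1 + z) + (2 + w′ + r)                    ≡⟨ rhs w′ k′ r z ⟩
  1 + (1 + ((1 + (w′ + (1 + (k′ + r)))) + z))        ∎
  where
  open ≤-Reasoning
  w′ = size (encodeWord w)
  k′ = size (encodeWord k)
  r  = size (encodeWords (Vec.toList ws))
  x  = size (encodeWords (List.map key L))
  y  = size (encodeTuples (sift L S))
  z  = size (encodeTuples L)
  rhs : ∀ w k r z → 1 + k + (1 + z) + (2 + w + r) ≡ 1 + (1 + ((1 + (w + (1 + (k + r)))) + z))
  rhs = solve-∀

size-duplicate : ∀ A → size (encodeTuples (List.map duplicate A)) ≤ 3 * size (encodeWords A)
size-duplicate []      = from-yes (1 ≤? 3)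
size-duplicate (w ∷ A) = begin
  1 + ((1 + (s + (1 + (s + 1)))) + x) ≡⟨ lhs s x ⟩
  -- Two copies and their cells cost `4 + 2 * s` per word against a budget of `3 + 3 * s`; `1 ≤ s`
  -- covers the difference.
  1 + (3 + 2 * s + x)
    ≤⟨ +-mono-≤ (size-positive (encodeWord w)) (+-monoʳ-≤ (3 + 2 * s) (size-duplicate A)) ⟩
  s + (3 + 2 * s + 3 * y)             ≡⟨ rhs s y ⟩
  3 * (1 + (s + y))                   ∎
  where
  open ≤-Reasoning
  s = size (encodeWord w)
  x = size (encodeTuples (List.map duplicate A))
  y = size (encodeWords A)
  lhs : ∀ s x → 1 + ((1 + (s + (1 + (s + 1)))) + x) ≡ 1 + (3 + 2 * s + x)
  lhs = solve-∀
  rhs : ∀ s y → s + (3 + 2 * s + 3 * y) ≡ 3 * (1 + (s + y))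
  rhs = solve-∀

-- Amortised cost of one round. The child's prepayment `c * suc s` covers the constant and the
-- marking of its solutions. The relation, of size `l`, pays for clearing and selecting (`w`) and
-- for handing the sifted relation (`r`) to the next round.
iteration-bound : ∀ c {k t₁ t₂ t₃ t₄ t₅ a b l r s w y} → k ≤ c →
                  t₁ + c * suc s ≤ c * a → t₂ + t₄ ≤ c * w → t₃ ≤ c * s →
                  t₅ + c * y ≤ c * suc (r + b) → w + r ≤ suc l →
                  k + (t₁ + t₂ + t₃ + t₄ + t₅) + c * y ≤ c * suc (l + suc (a + b))
iteration-bound c {k} {t₁} {t₂} {t₃} {t₄} {t₅} {a} {b} {l} {r} {s} {w} {y} k≤ t₁≤ t₂₄≤ t₃≤ t₅≤ w+r≤ = begin
  k + (t₁ + t₂ + t₃ + t₄ + t₅) + c * y                  ≡⟨ split k t₁ t₂ t₃ t₄ t₅ (c * y) ⟩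
  (k + t₃) + t₁ + (t₂ + t₄) + (t₅ + c * y)
    ≤⟨ +-mono-≤ (+-mono-≤ (+-monoˡ-≤ t₁ (+-mono-≤ k≤ t₃≤)) t₂₄≤) t₅≤ ⟩
  (c + c * s) + t₁ + c * w + c * suc (r + b)            ≡⟨ collect c s t₁ w r b ⟩
  (t₁ + c * suc s) + c * (w + r) + c * suc b
    ≤⟨ +-monoˡ-≤ (c * suc b) (+-mono-≤ t₁≤ (*-monoʳ-≤ c w+r≤)) ⟩
  c * a + c * suc l + c * suc b                         ≡⟨ join c a l b ⟩
  c * suc (l + suc (a + b))                             ∎
  where
  open ≤-Reasoning
  split : ∀ k t₁ t₂ t₃ t₄ t₅ z → k + (t₁ + t₂ + t₃ + t₄ + t₅) + z ≡ (k + t₃) + t₁ + (t₂ + t₄) + (t₅ + z)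
  split = solve-∀
  collect : ∀ c s t₁ w r b → (c + c * s) + t₁ + c * w + c * suc (r + b) ≡ (t₁ + c * suc s) + c * (w + r) + c * suc b
  collect = solve-∀
  join : ∀ c a l b → c * a + c * suc l + c * suc b ≡ c * suc (l + suc (a + b))
  join = solve-∀

total-bound : ∀ c {k t₁ t₂ t₃ l f a y} → .{{NonZero c}} → k ≤ c → t₂ ≤ c * a → l ≤ 3 * a →
              t₃ + 2 * c * y ≤ 2 * c * suc (l + suc (f + 1)) →
              k + (t₁ + t₂ + t₃) ≤ 8 * c * (t₁ + suc (a + f))
total-bound c {k} {t₁} {t₂} {t₃} {l} {f} {a} {y} k≤ t₂≤ l≤ t₃≤ = begin
  k + (t₁ + t₂ + t₃)                    ≡⟨ split k t₁ t₂ t₃ ⟩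
  t₁ + (k + t₂ + t₃)                    ≤⟨ +-mono-≤ (m≤n*m t₁ (8 * c) {{m*n≢0 8 c}}) (+-mono-≤ (+-mono-≤ k≤ t₂≤) t₃≤′) ⟩
  8 * c * t₁ + (c + c * a + 2 * c * suc (3 * a + suc (f + 1)))
    -- Beyond the term in `t₁`, the sum is `7 * c + 7 * c * a + 2 * c * f`; the padding raises every
    -- coefficient to `8 * c`.
    ≤⟨ m≤m+n _ (c + c * a + 6 * c * f) ⟩
  8 * c * t₁ + (c + c * a + 2 * c * suc (3 * a + suc (f + 1))) + (c + c * a + 6 * c * f)
                                        ≡⟨ join c t₁ a f ⟩
  8 * c * (t₁ + suc (a + f))            ∎
  where
  open ≤-Reasoning
  t₃≤′ : t₃ ≤ 2 * c * suc (3 * a + suc (f + 1))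
  t₃≤′ = m+n≤o⇒m≤o t₃ (≤-trans t₃≤ (*-monoʳ-≤ (2 * c) (s≤s (+-monoˡ-≤ (suc (f + 1)) l≤))))
  split : ∀ k t₁ t₂ t₃ → k + (t₁ + t₂ + t₃) ≡ t₁ + (k + t₂ + t₃)
  split = solve-∀
  join : ∀ c t a f → 8 * c * t + (c + c * a + 2 * c * suc (3 * a + suc (f + 1))) + (c + c * a + 6 * c * f)
                   ≡ 8 * c * (t + suc (a + f))
  join = solve-∀

nonempty? : ∀ {A : Set} (xs : List A) → Dec (∃ (_∈ xs))
nonempty? []       = no λ ()
nonempty? (x ∷ xs) = yes (x , here refl)

-- Only the empty list is encoded as `num 0`, so the machine's truth test is a test for
-- nonemptiness.
branch-⇓ : ∀ {k n} {body : Fin k → Expr k 1} {e : Expr k n} {ρ σ σ′ t m} (L : List (Vec Word m)) →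
           body ⊢⟨ e ∣ ρ ∣ σ ⟩⇓⟨ encodeTuples L ∣ σ′ ∣ t ⟩ →
           body ⊢⟨ ifElse e (lit 1) (lit 0) ∣ ρ ∣ σ ⟩⇓⟨ encodeBool (does (nonempty? L)) ∣ σ′ ∣ suc (t + 1) ⟩
branch-⇓ []      d = ifFalse d lit
branch-⇓ (_ ∷ _) d = ifTrue d pair lit

size-encodeBool : ∀ b → size (encodeBool b) ≡ 1
size-encodeBool false = refl
size-encodeBool true  = refl

load-≡ : ∀ {k n} {body : Fin k → Expr k 1} {e : Expr k n} {ρ σ σ′ i x t} →
         body ⊢⟨ e ∣ ρ ∣ σ ⟩⇓⟨ num i ∣ σ′ ∣ t ⟩ → σ′ i ≡ x → body ⊢⟨ load e ∣ ρ ∣ σ ⟩⇓⟨ x ∣ σ′ ∣ suc t ⟩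
load-≡ d refl = load d

-- The search program and the cost of its functions

module Evaluation (P : Program) where
  open Program P renaming (body to coreBody; main to coreMain)

  ι : Fin functions → Fin (6 + functions)
  ι = 6 ↑ʳ_

  body : Fin (6 + functions) → Expr (6 + functions) 1
  body code# = ifElse (var 0F)
    (letIn (call code# (snd (var 0F)))
      (add (add (lit 1) (fst (var 1F))) (add (var 0F) (add (var 0F) (lit 0)))))
    (lit 0)
  body clear# = setBody clear# (fst (snd (fst (var 0F)))) 0
  body mark# = setBody mark# (fst (fst (var 0F))) 1
  body select# = ifElse (var 0F)
    (letIn (call select# (snd (var 0F)))
      (ifElse (load (call code# (fst (snd (fst (var 1F))))))
        (pair (pair (fst (fst (var 1F))) (snd (snd (fst (var 1F))))) (var 0F))
        (var 0F)))
    (lit 0)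
  -- The child is solved before its keys are written, as solving it overwrites the memory.
  body loop# = ifElse (snd (var 0F))
    (letIn (call loop# (fst (snd (var 0F))))
      (letIn (call clear# (fst (var 1F)))
        (letIn (call mark# (var 1F))
          -- The sifted relation paired with the remaining subtrees again has the shape of an
          -- encoded node, now with one child fewer.
          (call loop# (pair (call select# (fst (var 3F))) (snd (snd (var 3F))))))))
    (fst (var 0F))
  body dup# = ifElse (var 0F)
    (pair (pair (fst (var 0F)) (pair (fst (var 0F)) (lit 0))) (call dup# (snd (var 0F))))
    (lit 0)
  body (fsuc (fsuc (fsuc (fsuc (fsuc (fsuc f)))))) = embed ι (coreBody f)

  infix 3 ⟨_∣_∣_⟩⇓⟨_∣_⟩≤_
  ⟨_∣_∣_⟩⇓⟨_∣_⟩≤_ : ∀ {n} → Expr (6 + functions) n → Vec Val n → Store → Val → Store → ℕ → Set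
  ⟨ e ∣ ρ ∣ σ ⟩⇓⟨ x ∣ σ′ ⟩≤ n = ∃ λ t → (body ⊢⟨ e ∣ ρ ∣ σ ⟩⇓⟨ x ∣ σ′ ∣ t ⟩) × t ≤ n

  code-⇓ : ∀ w σ → ⟨ body code# ∣ encodeWord w ∷ [] ∣ σ ⟩⇓⟨ num (code w) ∣ σ ⟩≤ c₀ * size (encodeWord w)
  code-⇓ []      σ = _ , ifFalse var lit , ≤c₀* 3 0
  -- Replacing `encodeBool b` by `num (bit b)` lets the addition rule apply without a case split on
  -- `b`.
  code-⇓ (b ∷ w) σ with encodeBool b | encodeBool-bit b | code-⇓ w σ
  ... | _ | refl | t , d , t≤ =
    _ , ifTrue var pair (letIn (call (snd var) d) (add (add lit (fst var)) (add var (add var lit))))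
      , ≤-trans (≤-reflexive (time t)) (absorb c₀ {a = 2} (≤c₀* 16 1) t≤)
    where
    time : ∀ t → suc (1 + suc (suc (2 + t) + 10)) ≡ 16 + t
    time = solve-∀

  module _ {A : Set} (enc : A → Val) (word : A → Word) self {e i d} (isSet : body self ≡ setBody self e i) (d≤4 : d ≤ 4)
           (e-⇓ : ∀ a xs σ → body ⊢⟨ e ∣ ⟨ enc a , xs ⟩ ∷ [] ∣ σ ⟩⇓⟨ encodeWord (word a) ∣ σ ∣ d ⟩) where

    -- Knowing the function only through `isSet` lets one induction serve both `clear#` and `mark#`;
    -- `d` is the cost of reading the word at the head of the list.
    set-⇓ : ∀ as σ →
            ⟨ body self ∣ encodeList (List.map enc as) ∷ [] ∣ σ ⟩⇓⟨ num 0 ∣ setAll (List.map word as) (num i) σ ⟩≤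
              c₀ * size (encodeWords (List.map word as))
    set-⇓ []       σ rewrite isSet = _ , ifFalse var lit , ≤c₀* 3 0
    set-⇓ (a ∷ as) σ with code-⇓ (word a) σ | set-⇓ as (σ [ code (word a) ≔ num i ])
    ... | t₁ , d₁ , t₁≤ | t₂ , d₂ , t₂≤ rewrite isSet =
      _ , ifTrue var pair (letIn (store (call (e-⇓ a _ σ) d₁) lit)
            (call (snd var) (subst (λ b → body ⊢⟨ b ∣ _ ∣ _ ⟩⇓⟨ _ ∣ _ ∣ t₂ ⟩) (sym isSet) d₂)))
        , ≤-trans (≤-reflexive (time d t₁ t₂)) (absorb₂ c₀ (≤-trans (+-monoʳ-≤ 9 d≤4) (≤c₀ 13)) t₁≤ t₂≤)
      where
      time : ∀ d t₁ t₂ → suc (1 + suc (suc (suc (d + t₁) + 1) + suc (2 + t₂))) ≡ 9 + d + (t₁ + t₂)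
      time = solve-∀

  clear-⇓ : ∀ {n} (L : List (Vec Word (2 + n))) σ →
            ⟨ body clear# ∣ encodeTuples L ∷ [] ∣ σ ⟩⇓⟨ num 0 ∣ setAll (List.map key L) (num 0) σ ⟩≤
              c₀ * size (encodeWords (List.map key L))
  clear-⇓ = set-⇓ (encodeWords ∘ Vec.toList) key clear# refl (from-yes (4 ≤? 4))
    λ { (_ ∷ _ ∷ _) _ _ → fst (snd (fst var)) }

  mark-⇓ : ∀ (S : List (Vec Word 1)) σ →
           ⟨ body mark# ∣ encodeTuples S ∷ [] ∣ σ ⟩⇓⟨ num 0 ∣ setAll (List.map Vec.head S) (num 1) σ ⟩≤
             c₀ * size (encodeWords (List.map Vec.head S))
  mark-⇓ = set-⇓ (encodeWords ∘ Vec.toList) Vec.head mark# refl (from-yes (3 ≤? 4))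
    λ { (_ ∷ []) _ _ → fst (fst var) }

  -- `select#` stores nothing, so the hypothesis on `σ` at the keys persists through the recursion.
  select-⇓ : ∀ {n} (L : List (Vec Word (2 + n))) S {σ} →
             All (λ v → σ (code (key v)) ≡ encodeBool (does (keyIn? S v))) L →
             ⟨ body select# ∣ encodeTuples L ∷ [] ∣ σ ⟩⇓⟨ encodeTuples (sift L S) ∣ σ ⟩≤
               c₀ * size (encodeWords (List.map key L))
  select-⇓ []                 S     []         = _ , ifFalse var lit , ≤c₀* 3 0
  select-⇓ ((w ∷ k ∷ ws) ∷ L) S {σ} (eq ∷ eqs)
    -- Abstracting the decision makes `filter` inside `sift` and the loaded value reduce together.
    with code-⇓ k σ | select-⇓ L S eqs | does (keyIn? S (w ∷ k ∷ ws)) | eq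
  ... | t₁ , d₁ , t₁≤ | t₂ , d₂ , t₂≤ | true | eq =
    _ , ifTrue var pair (letIn (call (snd var) d₂)
          (ifTrue (load-≡ (call (fst (snd (fst var))) d₁) eq) num
            (pair (pair (fst (fst var)) (snd (snd (fst var)))) var)))
      , ≤-trans (≤-reflexive (time t₁ t₂)) (absorb₂ c₀ (≤c₀ 23) t₁≤ t₂≤)
    where
    time : ∀ t₁ t₂ → suc (1 + suc (suc (2 + t₂) + suc (suc (suc (4 + t₁)) + 10))) ≡ 23 + (t₁ + t₂)
    time = solve-∀
  ... | t₁ , d₁ , t₁≤ | t₂ , d₂ , t₂≤ | false | eq =
    _ , ifTrue var pair (letIn (call (snd var) d₂)
          (ifFalse (load-≡ (call (fst (snd (fst var))) d₁) eq)
            var))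
      , ≤-trans (≤-reflexive (time t₁ t₂)) (absorb₂ c₀ (≤c₀ 14) t₁≤ t₂≤)
    where
    time : ∀ t₁ t₂ → suc (1 + suc (suc (2 + t₂) + suc (suc (suc (4 + t₁)) + 1))) ≡ 14 + (t₁ + t₂)
    time = solve-∀

  -- Paying in advance for reading the output makes the cost of a subtree telescope.
  Yields : Val → Val → Set
  Yields x y = ∀ σ → ∃₂ λ σ′ t →
    (body ⊢⟨ body loop# ∣ x ∷ [] ∣ σ ⟩⇓⟨ y ∣ σ′ ∣ t ⟩) × t + c₁ * suc (size y) ≤ c₁ * size x

  yields-leaf : ∀ {x} → Yields ⟨ x , num 0 ⟩ x
  yields-leaf {x} σ = _ , _ , ifFalse (snd var) (fst var) , bound
    where
    open ≤-Reasoning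
    time : ∀ c s → c + c * suc s ≡ c * suc (s + 1)
    time = solve-∀
    bound : 5 + c₁ * suc (size x) ≤ c₁ * suc (size x + 1)
    bound = begin
      -- The terminator `num 0` contributes one `c₁` beyond the prepayment, which pays for the five
      -- steps.
      5 + c₁ * suc (size x)  ≤⟨ +-monoˡ-≤ _ (≤-trans (≤c₀ 5) (m≤m+n c₀ _)) ⟩
      c₁ + c₁ * suc (size x) ≡⟨ time c₁ (size x) ⟩
      c₁ * suc (size x + 1)  ∎

  yields-child : ∀ {n} {L : List (Vec Word (2 + n))} {S x xs y} →
                 Yields x (encodeTuples S) → Yields ⟨ encodeTuples (sift L S) , xs ⟩ y →
                 Yields ⟨ encodeTuples L , ⟨ x , xs ⟩ ⟩ y
  yields-child {L = L} {S} {x} {xs} {y} child rest σ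
    with child σ
  ... | σ₁ , t₁ , d₁ , t₁≤
    with clear-⇓ L σ₁
  ... | t₂ , d₂ , t₂≤
    with mark-⇓ S (setAll (List.map key L) (num 0) σ₁)
  ... | t₃ , d₃ , t₃≤
    -- Every key of `L` was cleared before the marking, so each load answers membership among the
    -- child's solutions.
    with select-⇓ L S (All.tabulate λ v∈L → setAll-∈? (List.map Vec.head S) σ₁ (∈-map⁺ key v∈L))
  ... | t₄ , d₄ , t₄≤
    with rest (setAll (List.map Vec.head S) (num 1) (setAll (List.map key L) (num 0) σ₁))
  ... | σ₅ , t₅ , d₅ , t₅≤ =
    σ₅ , _ , ifTrue (snd var) pair (letIn (call (fst (snd var)) d₁)
               (letIn (call (fst var) d₂)
                 (letIn (call var d₃)
                   (call (pair (call (fst var) d₄) (snd (snd var))) d₅))))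
       , ≤-trans (≤-reflexive (cong (_+ c₁ * suc (size y)) (time t₁ t₂ t₃ t₄ t₅)))
           (iteration-bound c₁ (≤-trans (≤c₀ 23) (m≤m+n c₀ _)) t₁≤
             (≤-trans (+-mono-≤ t₂≤ t₄≤) (≤-reflexive (double c₀ _)))
             (≤-trans t₃≤ (*-mono-≤ (m≤m+n c₀ _) (size-heads S)))
             t₅≤ (size-sift L S))
    where
    time : ∀ t₁ t₂ t₃ t₄ t₅ →
           suc (2 + suc (suc (3 + t₁) + suc (suc (2 + t₂) + suc (suc (1 + t₃) + suc (suc (suc (2 + t₄) + 3) + t₅)))))
             ≡ 23 + (t₁ + t₂ + t₃ + t₄ + t₅)
    time = solve-∀
    double : ∀ c w → c * w + c * w ≡ 2 * c * w
    double = solve-∀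

  yields-solutions : ∀ {ω} (D : Decomposition ω) (R : Relation D) →
                     Yields (encodeFamily D (λ t → encodeTuples (R t))) (encodeTuples (solutions D R))
  yields-solutions (intro v a)      R = yields-leaf
  yields-solutions (union D₁ D₂ _)  R =
    yields-child (yields-solutions D₁ (R ∘ inLeft)) (yields-child (yields-solutions D₂ (R ∘ inRight)) yields-leaf)
  yields-solutions (recolor D a b)  R = yields-child (yields-solutions D (R ∘ inRecolor)) yields-leaf
  yields-solutions (addEdges D a b) R = yields-child (yields-solutions D (R ∘ inAddEdges)) yields-leaf

  dup-⇓ : ∀ A σ → ⟨ body dup# ∣ encodeWords A ∷ [] ∣ σ ⟩⇓⟨ encodeTuples (List.map duplicate A) ∣ σ ⟩≤
            c₀ * size (encodeWords A)
  dup-⇓ []      σ = _ , ifFalse var lit , ≤c₀* 3 0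
  dup-⇓ (w ∷ A) σ with dup-⇓ A σ
  ... | t , d , t≤ = _ , ifTrue var pair (pair (pair (fst var) (pair (fst var) lit)) (call (snd var) d))
                       , absorb c₀ {k = 13} {a = suc (size (encodeWord w))} (≤c₀* 13 _) t≤

  program : Program
  program = record
    { functions = 6 + functions
    ; body      = body
    ; main      = letIn (embed ι coreMain)
        (ifElse (call loop# (pair (call dup# (fst (var 0F))) (pair (snd (var 0F)) (lit 0)))) (lit 1) (lit 0))
    }

  program-runs : ∀ {z A x σ₁ t₁ m} (L : List (Vec Word m)) →
                 coreBody ⊢⟨ coreMain ∣ z ∷ [] ∣ (λ _ → num 0) ⟩⇓⟨ ⟨ encodeWords A , x ⟩ ∣ σ₁ ∣ t₁ ⟩ →
                 Yields ⟨ encodeTuples (List.map duplicate A) , ⟨ x , num 0 ⟩ ⟩ (encodeTuples L) →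
                 ∃ λ n → Runs program z (encodeBool (does (nonempty? L))) n ×
                         n ≤ 8 * c₀ * (t₁ + size ⟨ encodeWords A , x ⟩)
  program-runs {A = A} {x} {σ₁} {t₁} L d₁ yields with dup-⇓ A σ₁ | yields σ₁
  ... | t₂ , d₂ , t₂≤ | σ₃ , t₃ , d₃ , t₃≤ =
    _ , (σ₃ , _ , letIn (embed-⇓ ι (λ _ → refl) d₁)
                    (branch-⇓ L (call (pair (call (fst var) d₂) (pair (snd var) lit)) d₃)) , refl)
      -- `Runs` also charges the size of the answer, which is 1 for a Boolean.
      , ≤-trans (≤-reflexive (trans (+-comm _ (size (encodeBool (does (nonempty? L)))))
                   (trans (cong (_+ _) (size-encodeBool (does (nonempty? L)))) (time t₁ t₂ t₃))))
          (total-bound c₀ {{>-nonZero (≤c₀ 1)}} (≤c₀ 13) t₂≤ (size-duplicate A) t₃≤)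
    where
    time : ∀ t₁ t₂ t₃ → 1 + suc (t₁ + suc (suc (suc (suc (2 + t₂) + 4) + t₃) + 1)) ≡ 13 + (t₁ + t₂ + t₃)
    time = solve-∀

-- Deciding the graph problem

module _ (ℭ : Core) where
  open Core ℭ renaming (program to coreProgram)
  open Evaluation coreProgram

  accepts : ∀ {ω} (D : Decomposition ω) → ∃ λ n →
            Runs program (encodeDecomposition D) (encodeBool (does (nonempty? (accepted ℭ D)))) n × n ≤ 8 * c₀ * τ D
  accepts D = fromRun (runs D)
    where
    z = encodeDecomposition D
    b = encodeBool (does (nonempty? (accepted ℭ D)))
    fromRun : Runs coreProgram z ⟨ encodeWords (Accept D) , encodeFamily D (λ t → encodeTuples (Process D t)) ⟩ (τ D) →
              ∃ λ n → Runs program z b n × n ≤ 8 * c₀ * τ D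
    fromRun (σ , t , d , τ≡) = subst (λ n → ∃ λ m → Runs program z b m × m ≤ 8 * c₀ * n) (sym τ≡)
      -- The family of `D` is the only subtree of the additional node, whose relation consists of
      -- the duplicated accepted words.
      (program-runs (accepted ℭ D) d (yields-child (yields-solutions D (Process D)) yields-leaf))

theorem4 : ∀ {ℓ} (𝒫 : GraphProblem ℓ) (ℭ : Core) → Solves ℭ 𝒫 →
    Σ Program λ A → Σ ℕ λ c →
    ∀ (G : Graph) {ω : ℕ} (D : Decomposition ω) → D IsDecompositionOf G →
    Σ (Dec (𝒫 G)) λ G∈𝒫? → ∃ λ n →
    Runs A (encodeDecomposition D) (encodeBool (does G∈𝒫?)) n ×
    n ≤ c * (Core.τ ℭ D + ∣V D ∣ * Core.Size ℭ D)
theorem4 𝒫 ℭ solves = Evaluation.program (Core.program ℭ) , 8 * c₀ , λ G D isDec →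
  let n , run , n≤ = accepts ℭ D
      module 𝒫⇔ = Equivalence (solves G D isDec)
  -- `map′` keeps the Boolean of `nonempty?`, so the answer of the run is definitionally the one
  -- required.
  in map′ (𝒫⇔.from ∘ accepted⁻ ℭ D) (accepted⁺ ℭ D ∘ 𝒫⇔.to) (nonempty? (accepted ℭ D))
     , n , run , ≤-trans n≤ (*-monoʳ-≤ (8 * c₀) (m≤m+n (Core.τ ℭ D) _))
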